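{- Let $q\in\mathbb{N}$, let $\Psi_q:\mathbb{X}\to\mathbb{B}^q$ be a map, let $w_1,\dots,w_q\ge 0$ be weights with $\sum_{i=1}^q w_i=1$, and let $\hat k_q:\mathbb{X}\times\mathbb{X}\to\mathbb{R}$ be the associated binary-tree kernel $$\hat k_q(x,x')=\sum_{i=1}^q w_i\,\mathbf{1}\big(\Psi_i(x)=\Psi_i(x')\big).$$ Then its associated reproducing kernel Hilbert space $\mathcal{H}_{\hat k_q}$ contains only functions $f:\mathbb{X}\to\mathbb{R}$ that can be represented as $$f(x)=\sum_{i=1}^q\sqrt{w_i}\sum_{s\in\mathbb{B}^i}y_s\,\mathbf{1}\big(x\in\Xi_i(s)\big),\qquad x\in\mathbb{X},$$ for some $y_s\in\mathbb{R}$ ($s\in\mathbb{B}^i$, $i=1,\dots,q$). The resulting RKHS $\mathcal{H}_{\hat k_q}$ is finite dimensional, of dimension $\sum_{i=1}^q 2^i$, and is characterized by the piecewise-constant feature map $$\hat\phi_q(x):=\big[\sqrt{w_i}\,\mathbf{1}(x\in\Xi_i(s))\big]_{s\in\mathbb{B}^i,\ i\in\{1,\dots,q\}},$$ i.e. $\hat k_q(x,x')=\hat\phi_q(x)^\top\hat\phi_q(x')$ for all $x,x'\in\mathbb{X}$.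
   Context: $\mathbb{X}\subset\mathbb{R}^n$ is a state space and $\mathbb{B}=\{0,1\}$. The map $\Psi_q:\mathbb{X}\to\mathbb{B}^q$ encodes each state as a binary string of length $q$ (the precision, or bit-depth), thereby partitioning $\mathbb{X}$ into $2^q$ disjoint sets. For $1\le i\le q$, $\Psi_i(x)\in\mathbb{B}^i$ denotes the prefix consisting of the first $i$ bits of $\Psi_q(x)$. For $s\in\mathbb{B}^i$, $\Xi_i(s):=\{x\in\mathbb{X}:\Psi_i(x)=s\}$. $\mathbf{1}(b)$ equals $1$ if $b$ is true and $0$ otherwise. The RKHS of a (symmetric, positive-semidefinite) kernel $k$ is denoted $\mathcal{H}_k$.
   Formalization: "Of dimension ∑2^i" is false for the RKHS if q≥2 (functions are constant on at most 2^q cells). Proved instead: the space of coefficients y_s has dimension ∑2^i, the RKHS is exactly the set of the represented functions, and its dimension is finite and at most ∑2^i. -}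

module Defs where

open import Algebra.Bundles using (CommutativeRing)
open import Algebra.Structures using (IsCommutativeRing)
import Algebra.Properties.Semiring.Sum as SemiringSum
open import Data.Bool.Base using (Bool; true; false)
import Data.Bool.Properties as Bool
open import Data.Fin.Base using (Fin; toℕ)
open import Data.Fin.Properties using (toℕ<n)
open import Data.Nat.Base as ℕ using (ℕ; zero; suc)
open import Data.Product.Base using (Σ; ∃; _×_; _,_; proj₁; proj₂)
open import Data.Refinement using (Refinement)
open import Data.Sum.Base using (inj₁; inj₂)
open import Data.Vec.Base using (Vec; []; _∷_; truncate)
open import Data.Vec.Functional using (Vector; foldr)
open import Data.Vec.Properties using (≡-dec)
open import Level using (0ℓ)
open import Relation.Binary.Core using (Rel)
open import Relation.Binary.PropositionalEquality
  using (_≡_; _≢_; _≗_; sym; trans; subst; subst₂; cong; module ≡-Reasoning)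
open import Relation.Binary.Structures using (IsTotalOrder)
open import Relation.Nullary.Decidable.Core using (Dec; yes; no)
open import Relation.Unary using (Pred; _∈_; Satisfiable)

-- ℝ is axiomatised as a (Dedekind-)complete ordered field, which determines it
-- up to unique isomorphism in classical mathematics.

record RealNumbers : Set₁ where
  infix  8 -_
  infixl 7 _*_
  infixl 6 _+_
  infix  4 _≤_
  field
    ℝ                 : Set
    _+_ _*_           : ℝ → ℝ → ℝ
    -_                : ℝ → ℝ
    0# 1#             : ℝ
    _≤_               : Rel ℝ 0ℓ
    isCommutativeRing : IsCommutativeRing _≡_ _+_ _*_ -_ 0# 1#
    0≢1               : 0# ≢ 1#
    inverse           : ∀ x → x ≢ 0# → ∃ λ y → x * y ≡ 1#
    isTotalOrder      : IsTotalOrder _≡_ _≤_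
    +-monoʳ-≤         : ∀ z {x y} → x ≤ y → z + x ≤ z + y
    *-nonNeg          : ∀ {x y} → 0# ≤ x → 0# ≤ y → 0# ≤ x * y

  IsUpperBound : Pred ℝ 0ℓ → ℝ → Set
  IsUpperBound P b = ∀ x → x ∈ P → x ≤ b

  IsSupremum : Pred ℝ 0ℓ → ℝ → Set
  IsSupremum P s = IsUpperBound P s × (∀ b → IsUpperBound P b → s ≤ b)

  field
    supremum : ∀ P → Satisfiable P → ∃ (IsUpperBound P) → ∃ (IsSupremum P)

  commutativeRing : CommutativeRing 0ℓ 0ℓ
  commutativeRing = record { isCommutativeRing = isCommutativeRing }

  open CommutativeRing commutativeRing public
    using (semiring; ring; _-_; +-comm; +-identityˡ; +-identityʳ; -‿inverseˡ;
           -‿inverseʳ; zeroˡ; zeroʳ; *-identityˡ; *-identityʳ; distribˡ)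
  open IsTotalOrder isTotalOrder public
    using (total) renaming (refl to ≤-refl; trans to ≤-trans)
  open SemiringSum semiring public using (sum; sum-syntax)

  infix 4 _<_
  _<_ : Rel ℝ 0ℓ
  x < y = x ≤ y × x ≢ y

  private
    0≤y-x : ∀ {x y} → x ≤ y → 0# ≤ - x + y
    0≤y-x {x} {y} x≤y =
      subst (_≤ - x + y) (-‿inverseˡ x) (+-monoʳ-≤ (- x) x≤y)

    x≤x*y : ∀ {x y} → 0# ≤ x → 1# ≤ y → x ≤ x * y
    x≤x*y {x} {y} 0≤x 1≤y = subst₂ _≤_ (+-identityʳ x) eq (+-monoʳ-≤ x (*-nonNeg 0≤x (0≤y-x 1≤y)))
      where
      open CommutativeRing commutativeRing using (+-assoc)
      open ≡-Reasoning
      eq : x + x * (- 1# + y) ≡ x * y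
      eq = begin
        x + x * (- 1# + y)      ≡⟨ cong (_+ x * (- 1# + y)) (*-identityʳ x) ⟨
        x * 1# + x * (- 1# + y) ≡⟨ distribˡ x 1# (- 1# + y) ⟨
        x * (1# + (- 1# + y))   ≡⟨ cong (x *_) (+-assoc 1# (- 1#) y) ⟨
        x * (1# + - 1# + y)     ≡⟨ cong (λ z → x * (z + y)) (-‿inverseʳ 1#) ⟩
        x * (0# + y)            ≡⟨ cong (x *_) (+-identityˡ y) ⟩
        x * y                   ∎

    0≤1 : 0# ≤ 1#
    0≤1 with total 0# 1#
    ... | inj₁ 0≤1 = 0≤1
    ... | inj₂ 1≤0 = subst (0# ≤_) eq (*-nonNeg 0≤-1 0≤-1)
      where
      open import Algebra.Properties.Ring ring using (-1*x≈-x; -‿involutive)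
      0≤-1 : 0# ≤ - 1#
      0≤-1 = subst (0# ≤_) (+-identityʳ (- 1#)) (0≤y-x 1≤0)
      eq : - 1# * - 1# ≡ 1#
      eq = trans (-1*x≈-x (- 1#)) (-‿involutive 1#)

    squares-bounded : ∀ {a} → 0# ≤ a → IsUpperBound (λ x → x * x ≤ a) (a + 1#)
    squares-bounded {a} 0≤a x x²≤a with total x 1#
    ... | inj₁ x≤1 = ≤-trans x≤1
          (subst₂ _≤_ (+-identityʳ 1#) (+-comm 1# a) (+-monoʳ-≤ 1# 0≤a))
    ... | inj₂ 1≤x = ≤-trans (x≤x*y (≤-trans 0≤1 1≤x) 1≤x)
          (≤-trans x²≤a (subst (_≤ a + 1#) (+-identityʳ a) (+-monoʳ-≤ a 0≤1)))

  √-supremum : ∀ a → 0# ≤ a → ∃ (IsSupremum (λ x → x * x ≤ a))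
  √-supremum a 0≤a = supremum (λ x → x * x ≤ a)
    (0# , subst (_≤ a) (sym (zeroˡ 0#)) 0≤a)
    (a + 1# , squares-bounded 0≤a)

  √ : ∀ a → 0# ≤ a → ℝ
  √ a 0≤a = proj₁ (√-supremum a 0≤a)

  𝟏 : ∀ {P : Set} → Dec P → ℝ
  𝟏 (yes _) = 1#
  𝟏 (no _)  = 0#

module _ (R : RealNumbers) where
  open RealNumbers R

  -- d is the vector-space dimension of the linear subspace S of A → ℝ, witnessed
  -- by a basis of d elements.

  HasDimension : {A : Set} → Pred (A → ℝ) 0ℓ → ℕ → Set
  HasDimension {A} S d = Σ (Vector (A → ℝ) d) λ b →
      (∀ j → b j ∈ S)
    × (∀ f → f ∈ S → ∃ λ c → f ≗ combination b c)
    × (∀ c → combination b c ≗ (λ _ → 0#) → c ≗ (λ _ → 0#))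
    where
    combination : Vector (A → ℝ) d → Vector ℝ d → A → ℝ
    combination b c a = ∑[ j < d ] (c j * b j a)

  -- A Hilbert space of functions A → ℝ with reproducing kernel k.  Functions are
  -- identified when pointwise equal.  The inner product is a total operation whose
  -- values are constrained, and meaningful, only on members of the space.

  record RKHS {A : Set} (k : A → A → ℝ) : Set₁ where
    field
      space  : Pred (A → ℝ) 0ℓ
      ⟨_,_⟩  : (A → ℝ) → (A → ℝ) → ℝ

      ∈-resp : ∀ {f g} → f ≗ g → f ∈ space → g ∈ space
      0∈     : (λ _ → 0#) ∈ space
      +∈     : ∀ {f g} → f ∈ space → g ∈ space → (λ x → f x + g x) ∈ space
      *∈     : ∀ c {f} → f ∈ space → (λ x → c * f x) ∈ space

      ⟨⟩-cong : ∀ {f f′ g g′} → f ∈ space → g ∈ space →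
                f ≗ f′ → g ≗ g′ → ⟨ f , g ⟩ ≡ ⟨ f′ , g′ ⟩
      ⟨⟩-sym  : ∀ {f g} → f ∈ space → g ∈ space → ⟨ f , g ⟩ ≡ ⟨ g , f ⟩
      ⟨⟩-+    : ∀ {f g h} → f ∈ space → g ∈ space → h ∈ space →
                ⟨ (λ x → f x + g x) , h ⟩ ≡ ⟨ f , h ⟩ + ⟨ g , h ⟩
      ⟨⟩-*    : ∀ c {f h} → f ∈ space → h ∈ space →
                ⟨ (λ x → c * f x) , h ⟩ ≡ c * ⟨ f , h ⟩
      ⟨⟩-nonNeg   : ∀ {f} → f ∈ space → 0# ≤ ⟨ f , f ⟩
      ⟨⟩-definite : ∀ {f} → f ∈ space → ⟨ f , f ⟩ ≡ 0# → f ≗ (λ _ → 0#)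

    ‖_-_‖² : (A → ℝ) → (A → ℝ) → ℝ
    ‖ f - g ‖² = ⟨ (λ x → f x - g x) , (λ x → f x - g x) ⟩

    -- ‖ f - g ‖ < ε is expressed for ε > 0 as ‖ f - g ‖² < ε * ε.

    IsCauchy : (ℕ → A → ℝ) → Set
    IsCauchy f = ∀ ε → 0# < ε →
      ∃ λ N → ∀ m n → N ℕ.≤ m → N ℕ.≤ n → ‖ f m - f n ‖² < ε * ε

    ConvergesTo : (ℕ → A → ℝ) → (A → ℝ) → Set
    ConvergesTo f g = ∀ ε → 0# < ε →
      ∃ λ N → ∀ n → N ℕ.≤ n → ‖ f n - g ‖² < ε * ε

    field
      complete : ∀ f → (∀ n → f n ∈ space) → IsCauchy f →
                 ∃ λ g → g ∈ space × ConvergesTo f g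

      kernel∈     : ∀ x → (λ x′ → k x′ x) ∈ space
      reproducing : ∀ {f} → f ∈ space → ∀ x → ⟨ f , (λ x′ → k x′ x) ⟩ ≡ f x

-- Levels i = 1, …, q are indexed by Fin q, so that i : Fin q stands for the level
-- suc (toℕ i).

level : ∀ {q} → Fin q → ℕ
level i = suc (toℕ i)

Node : ℕ → Set
Node q = Σ (Fin q) λ i → Vec Bool (level i)

featureDimension : ℕ → ℕ
featureDimension q = foldr ℕ._+_ 0 {q} λ i → 2 ℕ.^ level i

module BinaryTree
  (R : RealNumbers) {n : ℕ} {𝕏 : Pred (Vec (RealNumbers.ℝ R) n) 0ℓ}
  {q : ℕ} (Ψ : Refinement (Vec (RealNumbers.ℝ R) n) 𝕏 → Vec Bool q)
  where
  open RealNumbers R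

  -- The points of 𝕏, with irrelevant membership proofs: points with equal
  -- coordinates are equal.
  Point : Set
  Point = Refinement (Vec ℝ n) 𝕏

  prefix : (i : Fin q) → Point → Vec Bool (level i)
  prefix i x = truncate (toℕ<n i) (Ψ x)

  Ξ : (i : Fin q) → Vec Bool (level i) → Pred Point 0ℓ
  Ξ i s x = prefix i x ≡ s

  _≟_ : ∀ {m} (s t : Vec Bool m) → Dec (s ≡ t)
  _≟_ = ≡-dec Bool._≟_

  Ξ? : ∀ i s x → Dec (x ∈ Ξ i s)
  Ξ? i s x = prefix i x ≟ s

  ∑𝔹 : ∀ m → (Vec Bool m → ℝ) → ℝ
  ∑𝔹 zero    f = f []
  ∑𝔹 (suc m) f = ∑𝔹 m (λ s → f (false ∷ s)) + ∑𝔹 m (λ s → f (true ∷ s))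

  infixl 10 ∑𝔹
  syntax ∑𝔹 m (λ s → e) = ∑[ s ∈𝔹 m ] e

  module _ (w : Fin q → ℝ) where

    k̂ : Point → Point → ℝ
    k̂ x x′ = ∑[ i < q ] (w i * 𝟏 (prefix i x ≟ prefix i x′))

    module _ (w≥0 : ∀ i → 0# ≤ w i) where

      φ̂ : Point → Node q → ℝ
      φ̂ x (i , s) = √ (w i) (w≥0 i) * 𝟏 (Ξ? i s x)

      treeFunction : (Node q → ℝ) → Point → ℝ
      treeFunction y x =
        ∑[ i < q ] (√ (w i) (w≥0 i) * ∑[ s ∈𝔹 level i ] (y (i , s) * 𝟏 (Ξ? i s x)))

  _·_ : (Node q → ℝ) → (Node q → ℝ) → ℝ
  u · v = ∑[ i < q ] (∑[ s ∈𝔹 level i ] (u (i , s) * v (i , s)))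

{-# OPTIONS --safe #-}
module Submission where

-- Enumerating the nodes turns k̂ into a finite sum Σⱼ φⱼ(x) φⱼ(x′), and for any such kernel
-- the RKHS is the span of the φⱼ.  Since f(x) = ⟨ f , k(·,x) ⟩ = Σⱼ ⟨ f , φⱼ ⟩ φⱼ(x), it is
-- enough that every Σⱼ cⱼ φⱼ belongs to the RKHS.  The c for which it does form a subspace W
-- of ℝᴺ containing every vector φ(x); projecting an arbitrary c orthogonally to W leaves
-- each c ∙ φ(x) unchanged, so c may be taken in W.

open import Defs
open import Algebra.Bundles using (CommutativeRing)
import Algebra.Properties.Ring as RingProperties
import Algebra.Properties.Semiring.Sum as SemiringSum
import Algebra.Solver.Ring.NaturalCoefficients.Default as RingSolver
open import Axiom.ExcludedMiddle using (ExcludedMiddle)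
open import Data.Bool.Base using (Bool; true; false)
open import Data.Empty using (⊥; ⊥-elim)
open import Data.Fin.Base using (Fin; zero; suc; splitAt)
import Data.Fin.Properties as Fin
open import Data.Nat.Base as ℕ using (ℕ; zero; suc)
import Data.Nat.Properties as ℕ
open import Data.Product.Base using (Σ; ∃; _×_; _,_; proj₁; proj₂)
open import Data.Refinement using (Refinement)
open import Data.Sum.Base using (_⊎_; inj₁; inj₂; map₁)
open import Data.Sum.Function.Propositional using (_⊎-↔_)
open import Data.Vec.Base using (Vec; []; _∷_)
open import Data.Vec.Functional as Vector using (Vector; foldr; head; tail)
open import Function.Base using (_∘_)
open import Function.Bundles using (_↔_; Inverse; mk↔ₛ′)
open import Function.Properties.Inverse using (↔-trans)
open import Level using (0ℓ)
open import Relation.Binary.PropositionalEquality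
  using (_≡_; _≢_; _≗_; refl; sym; trans; cong; cong₂; subst; subst₂; module ≡-Reasoning)
open import Relation.Binary.Structures using (IsTotalOrder)
open import Relation.Nullary.Decidable.Core using (Dec; yes; no; decidable-stable)
open import Relation.Unary using (Pred; _∈_; U)

open Inverse using (to; from; strictlyInverseˡ; strictlyInverseʳ)

-- Enumeration of the tree nodes.

Σ-uncons-↔ : ∀ {q} {B : Fin (suc q) → Set} → (B zero ⊎ Σ (Fin q) (B ∘ suc)) ↔ Σ (Fin (suc q)) B
Σ-uncons-↔ = mk↔ₛ′
  (λ { (inj₁ b) → zero , b ; (inj₂ (i , b)) → suc i , b })
  (λ { (zero , b) → inj₁ b ; (suc i , b) → inj₂ (i , b) })
  (λ { (zero , b) → refl ; (suc i , b) → refl })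
  (λ { (inj₁ b) → refl ; (inj₂ (i , b)) → refl })

-- The fibres are listed one after another. The total size is the same `foldr` that defines
-- `featureDimension`, so the node count comes out in the required form by computation.
Σ-↔ : ∀ {q} {f : Fin q → ℕ} {B : Fin q → Set} →
      (∀ i → Fin (f i) ↔ B i) → Fin (foldr ℕ._+_ 0 f) ↔ Σ (Fin q) B
Σ-↔ {zero}  e = mk↔ₛ′ (λ ()) (λ ()) (λ ()) (λ ())
Σ-↔ {suc q} e = ↔-trans Fin.+↔⊎ (↔-trans (e zero ⊎-↔ Σ-↔ (e ∘ suc)) Σ-uncons-↔)

∷-↔ : ∀ {m} → Σ (Fin 2) (λ _ → Vec Bool m) ↔ Vec Bool (suc m)
∷-↔ = mk↔ₛ′
  (λ { (zero , s) → false ∷ s ; (suc zero , s) → true ∷ s })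
  (λ { (false ∷ s) → zero , s ; (true ∷ s) → suc zero , s })
  (λ { (false ∷ s) → refl ; (true ∷ s) → refl })
  (λ { (zero , s) → refl ; (suc zero , s) → refl })

bits-↔ : ∀ m → Fin (2 ℕ.^ m) ↔ Vec Bool m
bits-↔ zero    = mk↔ₛ′ (λ _ → []) (λ _ → zero) (λ { [] → refl }) (λ { zero → refl })
-- 2 ^ suc m unfolds to the sum of 2 ^ m over Fin 2.
bits-↔ (suc m) = ↔-trans (Σ-↔ (λ (_ : Fin 2) → bits-↔ m)) ∷-↔

node-↔ : ∀ q → Fin (featureDimension q) ↔ Node q
node-↔ q = Σ-↔ (λ i → bits-↔ (level i))

-- Order and square roots in the real field.

module OrderedField (em : ExcludedMiddle 0ℓ) (R : RealNumbers) where
  open RealNumbers R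
  open CommutativeRing commutativeRing public
    using (+-assoc; *-assoc; *-comm; distribʳ; commutativeSemiring)
  open RingProperties ring using (-‿distribˡ-*; -‿distribʳ-*; -‿involutive)
  open IsTotalOrder isTotalOrder using (antisym; reflexive)
  open RingSolver commutativeSemiring using (solve; _:=_; _:+_; _:*_; con)
  open ≡-Reasoning

  +-nonNegʳ : ∀ x {y} → 0# ≤ y → x ≤ x + y
  +-nonNegʳ x {y} 0≤y = subst (_≤ x + y) (+-identityʳ x) (+-monoʳ-≤ x 0≤y)

  +-nonNeg : ∀ {x y} → 0# ≤ x → 0# ≤ y → 0# ≤ x + y
  +-nonNeg {x} 0≤x 0≤y = ≤-trans 0≤x (+-nonNegʳ x 0≤y)

  -- Turns an inequality into an equation without subtraction, which suits the commutative-semiring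
  -- solver.
  ≤⇒∃+ : ∀ {x y} → x ≤ y → ∃ λ d → 0# ≤ d × y ≡ x + d
  ≤⇒∃+ {x} {y} x≤y = - x + y ,
    subst (_≤ - x + y) (-‿inverseˡ x) (+-monoʳ-≤ (- x) x≤y) ,
    (begin
      y              ≡⟨ +-identityˡ y ⟨
      0# + y         ≡⟨ cong (_+ y) (-‿inverseʳ x) ⟨
      x + - x + y    ≡⟨ +-assoc x (- x) y ⟩
      x + (- x + y)  ∎)

  *-monoʳ-≤ : ∀ {z x y} → 0# ≤ z → x ≤ y → z * x ≤ z * y
  *-monoʳ-≤ {z} {x} 0≤z x≤y with ≤⇒∃+ x≤y
  ... | d , 0≤d , refl = subst (z * x ≤_) (sym (distribˡ z x d))
                               (+-nonNegʳ (z * x) (*-nonNeg 0≤z 0≤d))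

  0≤x*x : ∀ x → 0# ≤ x * x
  0≤x*x x with total 0# x
  ... | inj₁ 0≤x = *-nonNeg 0≤x 0≤x
  ... | inj₂ x≤0 = subst (0# ≤_) eq (*-nonNeg 0≤-x 0≤-x)
    where
    0≤-x : 0# ≤ - x
    0≤-x = subst₂ _≤_ (-‿inverseˡ x) (+-identityʳ (- x)) (+-monoʳ-≤ (- x) x≤0)
    eq : - x * - x ≡ x * x
    eq = begin
      - x * - x      ≡⟨ -‿distribˡ-* x (- x) ⟨
      - (x * - x)    ≡⟨ cong -_ (-‿distribʳ-* x x) ⟨
      - - (x * x)    ≡⟨ -‿involutive (x * x) ⟩
      x * x          ∎

  0≤1 : 0# ≤ 1#
  0≤1 = subst (0# ≤_) (*-identityʳ 1#) (0≤x*x 1#)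

  nonNeg-sum-≡0 : ∀ {x y} → 0# ≤ x → 0# ≤ y → x + y ≡ 0# → y ≡ 0#
  nonNeg-sum-≡0 {x} {y} 0≤x 0≤y x+y≡0 =
    antisym (subst₂ _≤_ refl (trans (+-comm y x) x+y≡0) (+-nonNegʳ y 0≤x)) 0≤y

  x+1≢0 : ∀ {x} → 0# ≤ x → x + 1# ≢ 0#
  x+1≢0 0≤x x+1≡0 = 0≢1 (sym (nonNeg-sum-≡0 0≤x 0≤1 x+1≡0))

  x*y⁻¹*y≡x : ∀ x {y} (y≢0 : y ≢ 0#) → x * proj₁ (inverse y y≢0) * y ≡ x
  x*y⁻¹*y≡x x {y} y≢0 = trans (*-assoc x _ y)
    (trans (cong (x *_) (trans (*-comm _ y) (proj₂ (inverse y y≢0)))) (*-identityʳ x))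

  *-cancelʳ-≡ : ∀ {x y z} → z ≢ 0# → x * z ≡ y * z → x ≡ y
  *-cancelʳ-≡ {x} {y} {z} z≢0 xz≡yz = trans (sym (divide x)) (trans (cong (_* z⁻¹) xz≡yz) (divide y))
    where
    z⁻¹ : ℝ
    z⁻¹ = proj₁ (inverse z z≢0)
    divide : ∀ u → u * z * z⁻¹ ≡ u
    divide u = trans (*-assoc u z z⁻¹)
      (trans (cong (u *_) (proj₂ (inverse z z≢0))) (*-identityʳ u))

  -- Totality leaves only `y ≤ x` to treat; multiplying it by `z` gives the reverse inequality of
  -- products, so the products agree and `z` cancels. The sign of the inverse of `z` never has to be
  -- determined.
  *-cancelʳ-≤ : ∀ {x y z} → 0# ≤ z → z ≢ 0# → x * z ≤ y * z → x ≤ y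
  *-cancelʳ-≤ {x} {y} {z} 0≤z z≢0 xz≤yz with total x y
  ... | inj₁ x≤y = x≤y
  ... | inj₂ y≤x = reflexive (*-cancelʳ-≡ z≢0 (antisym xz≤yz
          (subst₂ _≤_ (*-comm z y) (*-comm z x) (*-monoʳ-≤ 0≤z y≤x))))

  *-≢0 : ∀ {x y} → x ≢ 0# → y ≢ 0# → x * y ≢ 0#
  *-≢0 x≢0 y≢0 xy≡0 = x≢0 (*-cancelʳ-≡ y≢0 (trans xy≡0 (sym (zeroˡ _))))

  x*x≡0⇒x≡0 : ∀ {x} → x * x ≡ 0# → x ≡ 0#
  x*x≡0⇒x≡0 xx≡0 = decidable-stable em (λ x≢0 → *-≢0 x≢0 x≢0 xx≡0)

  -- If instead `x = y + d` with `d` nonnegative, expanding the square leaves `2yd + d² ≤ 0`, a sum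
  -- of nonnegative terms, so `d` vanishes.
  square-cancel-≤ : ∀ {x y} → 0# ≤ y → x * x ≤ y * y → x ≤ y
  square-cancel-≤ {x} {y} 0≤y xx≤yy with total x y
  ... | inj₁ x≤y = x≤y
  ... | inj₂ y≤x with ≤⇒∃+ y≤x
  ...   | d , 0≤d , refl = subst (_≤ y) (sym (trans (cong (y +_) d≡0) (+-identityʳ y))) ≤-refl
    where
    expand : (y + d) * (y + d) ≡ y * y + ((y * d + y * d) + d * d)
    expand = solve 2 (λ y d → (y :+ d) :* (y :+ d) := y :* y :+ ((y :* d :+ y :* d) :+ d :* d))
                   refl y d
    0≤yd : 0# ≤ y * d
    0≤yd = *-nonNeg 0≤y 0≤d
    0≤e : 0# ≤ (y * d + y * d) + d * d
    0≤e = +-nonNeg (+-nonNeg 0≤yd 0≤yd) (0≤x*x d)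
    e≤0 : (y * d + y * d) + d * d ≤ 0#
    e≤0 = subst₂ _≤_
      (trans (sym (+-assoc (- (y * y)) (y * y) _))
        (trans (cong (_+ _) (-‿inverseˡ (y * y))) (+-identityˡ _)))
      (-‿inverseˡ (y * y))
      (+-monoʳ-≤ (- (y * y)) (subst (_≤ y * y) expand xx≤yy))
    d≡0 : d ≡ 0#
    d≡0 = x*x≡0⇒x≡0 (nonNeg-sum-≡0 (+-nonNeg 0≤yd 0≤yd) (0≤x*x d) (antisym e≤0 0≤e))

  -- With c = a + 1, the number t = (s c + a) / (s + c) satisfies
  -- (t² - a) (s + c)² = (s² - a) (c² - a)  and  (t - s) (s + c) = a - s²,
  -- where c² - a = a² + a + 1.  So t lies between s and √ a; comparing it with
  -- the supremum s rules out both s² < a and a < s².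
  √-square : ∀ a (0≤a : 0# ≤ a) → √ a 0≤a * √ a 0≤a ≡ a
  √-square a 0≤a with √-supremum a 0≤a
  ... | s , upper , least = by-cases (total (s * s) a)
    where
    c D N u : ℝ
    c = a + 1#
    D = s + c
    N = s * c + a
    u = a * a + a + 1#

    0≤s : 0# ≤ s
    0≤s = upper 0# (subst (_≤ a) (sym (zeroˡ 0#)) 0≤a)

    0≤c : 0# ≤ c
    0≤c = +-nonNeg 0≤a 0≤1

    0≤D : 0# ≤ D
    0≤D = +-nonNeg 0≤s 0≤c

    D≢0 : D ≢ 0#
    D≢0 D≡0 = x+1≢0 (+-nonNeg 0≤s 0≤a) (trans (+-assoc s a 1#) D≡0)

    0≤u : 0# ≤ u
    0≤u = +-nonNeg (+-nonNeg (0≤x*x a) 0≤a) 0≤1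

    t : ℝ
    t = N * proj₁ (inverse D D≢0)

    tD≡N : t * D ≡ N
    tD≡N = x*y⁻¹*y≡x N D≢0

    ttDD≡NN : (t * t) * (D * D) ≡ N * N
    ttDD≡NN = trans
      (solve 2 (λ t D → (t :* t) :* (D :* D) := (t :* D) :* (t :* D)) refl t D)
      (cong₂ _*_ tD≡N tD≡N)

    0≤t : 0# ≤ t
    0≤t = *-cancelʳ-≤ 0≤D D≢0 (subst₂ _≤_ (sym (zeroˡ D)) (sym tD≡N)
      (+-nonNeg (*-nonNeg 0≤s 0≤c) 0≤a))

    sD≡ : s * D ≡ s * c + s * s
    sD≡ = trans (distribˡ s s c) (+-comm _ _)

    cancel-+ : ∀ {x y z} → x + y ≤ x + z → y ≤ z
    cancel-+ {x} {y} {z} le = subst₂ _≤_ (strip y) (strip z) (+-monoʳ-≤ (- x) le)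
      where
      strip : ∀ v → - x + (x + v) ≡ v
      strip v = trans (sym (+-assoc (- x) x v)) (trans (cong (_+ v) (-‿inverseˡ x)) (+-identityˡ v))

    DD≢0 : D * D ≢ 0#
    DD≢0 = *-≢0 D≢0 D≢0

    by-cases : s * s ≤ a ⊎ a ≤ s * s → s * s ≡ a
    -- Here `t` belongs to the set whose supremum is `s`. Multiplied by `D`, the bound `t ≤ s` reads
    -- `s c + a ≤ s c + s²`, and `s c` cancels.
    by-cases (inj₁ ss≤a) = antisym ss≤a (cancel-+ (subst₂ _≤_ tD≡N sD≡ tD≤sD))
      where
      d = proj₁ (≤⇒∃+ ss≤a)
      0≤d = proj₁ (proj₂ (≤⇒∃+ ss≤a))
      a≡ = proj₂ (proj₂ (≤⇒∃+ ss≤a))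

      -- The first identity rearranged to be free of subtraction; replacing `a` by `s² + d`
      -- everywhere makes it a polynomial identity in `s` and `d`.
      key : a * (D * D) ≡ N * N + d * u
      key = subst (λ b → b * ((s + (b + 1#)) * (s + (b + 1#))) ≡
                         (s * (b + 1#) + b) * (s * (b + 1#) + b) + d * (b * b + b + 1#)) (sym a≡)
        (solve 2 (λ s d → let b = s :* s :+ d ; o = con 1 in
            b :* ((s :+ (b :+ o)) :* (s :+ (b :+ o))) :=
            (s :* (b :+ o) :+ b) :* (s :* (b :+ o) :+ b) :+ d :* (b :* b :+ b :+ o)) refl s d)

      tt≤a : t * t ≤ a
      tt≤a = *-cancelʳ-≤ (0≤x*x D) DD≢0
        (subst₂ _≤_ (sym ttDD≡NN) (sym key) (+-nonNegʳ (N * N) (*-nonNeg 0≤d 0≤u)))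

      tD≤sD : t * D ≤ s * D
      tD≤sD = subst₂ _≤_ (*-comm D t) (*-comm D s) (*-monoʳ-≤ 0≤D (upper t tt≤a))
    by-cases (inj₂ a≤ss) = antisym (cancel-+ (subst₂ _≤_ sD≡ tD≡N sD≤tD)) a≤ss
      where
      d = proj₁ (≤⇒∃+ a≤ss)
      0≤d = proj₁ (proj₂ (≤⇒∃+ a≤ss))
      ss≡ = proj₂ (proj₂ (≤⇒∃+ a≤ss))

      m : ℝ
      m = s * c * a + s * c * a

      -- Now `s²` is known in terms of `a` and `d`, but `s` is not. The cross term, linear in `s`,
      -- is therefore kept as the atom `m` while `s * s` is exchanged for `a + d` and back.
      key : N * N ≡ a * (D * D) + d * u
      key = begin
        N * N
          ≡⟨ solve 3 (λ s a c →
               (s :* c :+ a) :* (s :* c :+ a) :=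
               (s :* s) :* (c :* c) :+ ((s :* c :* a :+ s :* c :* a) :+ a :* a)) refl s a c ⟩
        s * s * (c * c) + (m + a * a)
          ≡⟨ cong (λ z → z * (c * c) + (m + a * a)) ss≡ ⟩
        (a + d) * (c * c) + (m + a * a)
          ≡⟨ solve 3 (λ m a d → let c = a :+ con 1 in
               (a :+ d) :* (c :* c) :+ (m :+ a :* a) :=
               a :* (a :+ d) :+ (m :+ a :* (c :* c)) :+ d :* (a :* a :+ a :+ con 1)) refl m a d ⟩
        a * (a + d) + (m + a * (c * c)) + d * u
          ≡⟨ cong (λ z → a * z + (m + a * (c * c)) + d * u) ss≡ ⟨
        a * (s * s) + (m + a * (c * c)) + d * u
          ≡⟨ cong (_+ d * u) (solve 3 (λ s a c →
               a :* (s :* s) :+ ((s :* c :* a :+ s :* c :* a) :+ a :* (c :* c)) :=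
               a :* ((s :+ c) :* (s :+ c))) refl s a c) ⟩
        a * (D * D) + d * u ∎

      a≤tt : a ≤ t * t
      a≤tt = *-cancelʳ-≤ (0≤x*x D) DD≢0
        (subst₂ _≤_ refl (trans (sym key) (sym ttDD≡NN)) (+-nonNegʳ (a * (D * D)) (*-nonNeg 0≤d 0≤u)))

      s≤t : s ≤ t
      s≤t = least t (λ x xx≤a → square-cancel-≤ 0≤t (≤-trans xx≤a a≤tt))

      sD≤tD : s * D ≤ t * D
      sD≤tD = subst₂ _≤_ (*-comm D s) (*-comm D t) (*-monoʳ-≤ 0≤D s≤t)

-- Finite sums, linear combinations and subspaces.

module LinearAlgebra (em : ExcludedMiddle 0ℓ) (R : RealNumbers) where
  open RealNumbers R
  open OrderedField em R
  open SemiringSum semiring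
    using (sum-cong-≗; sum-replicate-zero; ∑-distrib-+; *-distribˡ-sum)
  open RingSolver commutativeSemiring using (solve; _:=_; _:+_; _:*_)
  open RingProperties ring using (-1*x≈-x; -‿distribˡ-*; +-inverseˡ-unique)
  open ≡-Reasoning

  sum-zero : ∀ {n} {g : Vector ℝ n} → (∀ j → g j ≡ 0#) → sum g ≡ 0#
  sum-zero {n} g≡0 = trans (sum-cong-≗ g≡0) (sum-replicate-zero n)

  sum-pick : ∀ {n} (g : Vector ℝ n) i → (∀ j → j ≢ i → g j ≡ 0#) → sum g ≡ g i
  sum-pick g zero    g≡0 = trans (cong (g zero +_) (sum-zero (λ j → g≡0 (suc j) λ ()))) (+-identityʳ _)
  sum-pick g (suc i) g≡0 = trans (cong₂ _+_ (g≡0 zero λ ())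
    (sum-pick (tail g) i (λ j j≢i → g≡0 (suc j) (j≢i ∘ Fin.suc-injective)))) (+-identityˡ _)

  sum-nonNeg : ∀ {n} {g : Vector ℝ n} → (∀ j → 0# ≤ g j) → 0# ≤ sum g
  sum-nonNeg {zero}  0≤g = ≤-refl
  sum-nonNeg {suc n} 0≤g = +-nonNeg (0≤g zero) (sum-nonNeg (0≤g ∘ suc))

  sum-splitAt : ∀ m {n} (g : Fin m ⊎ Fin n → ℝ) →
                sum (g ∘ splitAt m) ≡ sum (g ∘ inj₁) + sum (g ∘ inj₂)
  sum-splitAt zero    g = sym (+-identityˡ _)
  sum-splitAt (suc m) g = trans (cong (g (inj₁ zero) +_) (sum-splitAt m (g ∘ map₁ suc)))
                                (sym (+-assoc _ _ _))

  sum-Σ-↔ : ∀ {q} {f : Fin q → ℕ} {B : Fin q → Set} (e : ∀ i → Fin (f i) ↔ B i) (g : Σ (Fin q) B → ℝ) →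
            sum (g ∘ to (Σ-↔ e)) ≡ ∑[ i < q ] (∑[ j < f i ] (g (i , to (e i) j)))
  sum-Σ-↔ {zero}      e g = refl
  sum-Σ-↔ {suc q} {f} e g = trans
    (sum-splitAt (f zero) (g ∘ to (↔-trans (e zero ⊎-↔ Σ-↔ (e ∘ suc)) Σ-uncons-↔)))
    (cong (sum (λ j → g (zero , to (e zero) j)) +_)
          (sum-Σ-↔ (e ∘ suc) (g ∘ to Σ-uncons-↔ ∘ inj₂)))

  𝟏-yes : ∀ {P : Set} (P? : Dec P) → P → 𝟏 P? ≡ 1#
  𝟏-yes (yes _) p = refl
  𝟏-yes (no ¬p) p = ⊥-elim (¬p p)

  𝟏-no : ∀ {P : Set} (P? : Dec P) → (P → ⊥) → 𝟏 P? ≡ 0#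
  𝟏-no (yes p) ¬p = ⊥-elim (¬p p)
  𝟏-no (no _)  ¬p = refl

  -- Repeats the local definition inside `HasDimension`, with which it agrees by computation.
  combination : ∀ {A : Set} {n} → Vector (A → ℝ) n → Vector ℝ n → A → ℝ
  combination {n = n} b c a = ∑[ j < n ] (c j * b j a)

  combination-cong : ∀ {A : Set} {n} (b : Vector (A → ℝ) n) {c c′} → c ≗ c′ → combination b c ≗ combination b c′
  combination-cong b c≗c′ a = sum-cong-≗ (λ j → cong (_* b j a) (c≗c′ j))

  combination-0 : ∀ {A : Set} {n} (b : Vector (A → ℝ) n) → combination b (λ _ → 0#) ≗ (λ _ → 0#)
  combination-0 b a = sum-zero (λ j → zeroˡ (b j a))

  combination-+ : ∀ {A : Set} {n} (b : Vector (A → ℝ) n) c c′ →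
                  combination b (λ j → c j + c′ j) ≗ λ a → combination b c a + combination b c′ a
  combination-+ b c c′ a = trans (sum-cong-≗ (λ j → distribʳ (b j a) (c j) (c′ j)))
    (∑-distrib-+ (λ j → c j * b j a) (λ j → c′ j * b j a))

  combination-* : ∀ {A : Set} {n} (b : Vector (A → ℝ) n) r c →
                  combination b (λ j → r * c j) ≗ λ a → r * combination b c a
  combination-* b r c a = trans (sum-cong-≗ (λ j → *-assoc r (c j) (b j a)))
    (sym (*-distribˡ-sum r (λ j → c j * b j a)))

  unit : ∀ {n} → Fin n → Vector ℝ n
  unit i j = 𝟏 (j Fin.≟ i)

  combination-unit : ∀ {A : Set} {n} (b : Vector (A → ℝ) n) i → combination b (unit i) ≗ b i
  combination-unit b i a = trans
    (sum-pick _ i (λ j j≢i → trans (cong (_* b j a) (𝟏-no (j Fin.≟ i) j≢i)) (zeroˡ _)))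
    (trans (cong (_* b i a) (𝟏-yes (i Fin.≟ i) refl)) (*-identityˡ _))

  -- Serves both for function spaces and, with `A = Fin n`, for coordinate vectors. The field `resp`
  -- stands in for function extensionality.
  record Subspace {A : Set} (S : Pred (A → ℝ) 0ℓ) : Set where
    field
      resp     : ∀ {f g} → f ≗ g → f ∈ S → g ∈ S
      0-closed : (λ _ → 0#) ∈ S
      +-closed : ∀ {f g} → f ∈ S → g ∈ S → (λ x → f x + g x) ∈ S
      *-closed : ∀ c {f} → f ∈ S → (λ x → c * f x) ∈ S

    combination-closed : ∀ {n} {b : Vector (A → ℝ) n} → (∀ j → b j ∈ S) → ∀ c → combination b c ∈ S
    combination-closed {zero}  b∈ c = 0-closed
    combination-closed {suc n} b∈ c =
      +-closed (*-closed (c zero) (b∈ zero)) (combination-closed (b∈ ∘ suc) (tail c))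

  -- Dot product and orthogonal projection.

  infix 8 _∙_
  _∙_ : ∀ {n} → Vector ℝ n → Vector ℝ n → ℝ
  _∙_ {n} u v = ∑[ j < n ] (u j * v j)

  ∙-comm : ∀ {n} (u v : Vector ℝ n) → u ∙ v ≡ v ∙ u
  ∙-comm u v = sum-cong-≗ (λ j → *-comm (u j) (v j))

  ∙-linearʳ : ∀ {n} (v u u′ : Vector ℝ n) r → v ∙ (λ j → r * u j + u′ j) ≡ r * (v ∙ u) + v ∙ u′
  ∙-linearʳ v u u′ r = begin
    v ∙ (λ j → r * u j + u′ j)
      ≡⟨ sum-cong-≗ (λ j → solve 4 (λ v u u′ r → v :* (r :* u :+ u′) := r :* (v :* u) :+ v :* u′)
                                   refl (v j) (u j) (u′ j) r) ⟩
    ∑[ j < _ ] (r * (v j * u j) + v j * u′ j)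
      ≡⟨ ∑-distrib-+ (λ j → r * (v j * u j)) (λ j → v j * u′ j) ⟩
    ∑[ j < _ ] (r * (v j * u j)) + v ∙ u′
      ≡⟨ cong (_+ v ∙ u′) (*-distribˡ-sum r (λ j → v j * u j)) ⟨
    r * (v ∙ u) + v ∙ u′ ∎

  ∙-linearˡ : ∀ {n} (u u′ v : Vector ℝ n) r → (λ j → r * u j + u′ j) ∙ v ≡ r * (u ∙ v) + u′ ∙ v
  ∙-linearˡ u u′ v r = trans (∙-comm _ v)
    (trans (∙-linearʳ v u u′ r) (cong₂ (λ x y → r * x + y) (∙-comm v u) (∙-comm v u′)))

  0∷_ : ∀ {n} → Vector ℝ n → Vector ℝ (suc n)
  0∷ v = 0# Vector.∷ v

  0*x+y≡y : ∀ x y → 0# * x + y ≡ y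
  0*x+y≡y x y = trans (cong (_+ y) (zeroˡ x)) (+-identityˡ y)

  0∷-∙ : ∀ {n} (v : Vector ℝ n) u → (0∷ v) ∙ u ≡ v ∙ tail u
  0∷-∙ v u = 0*x+y≡y (head u) (v ∙ tail u)

  0∷-subspace : ∀ {n} {W : Pred (Vector ℝ (suc n)) 0ℓ} → Subspace W → Subspace (λ v → 0∷ v ∈ W)
  0∷-subspace W-sub = record
    { resp     = λ v≗v′ → resp (λ { zero → refl ; (suc j) → v≗v′ j })
    ; 0-closed = resp (λ { zero → refl ; (suc j) → refl }) 0-closed
    ; +-closed = λ v∈ v′∈ → resp (λ { zero → +-identityˡ 0# ; (suc j) → refl }) (+-closed v∈ v′∈)
    ; *-closed = λ c v∈ → resp (λ { zero → zeroʳ c ; (suc j) → refl }) (*-closed c v∈)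
    }
    where open Subspace W-sub

  -- Induction on n: the vectors of W with vanishing first entry form a subspace of
  -- ℝⁿ, whose orthogonal complement in W is spanned by at most one vector d.
  project : ∀ {n} {W : Pred (Vector ℝ n) 0ℓ} → Subspace W →
            ∀ e → ∃ λ p → p ∈ W × (∀ v → v ∈ W → v ∙ e ≡ v ∙ p)
  project {zero}      W-sub e = (λ _ → 0#) ,
    Subspace.resp W-sub (λ ()) (Subspace.0-closed W-sub) , λ _ _ → refl
  project {suc n} {W} W-sub e
    -- If every vector of `W` has first entry zero, the projection found one dimension lower is
    -- already the answer.
    with em {∃ λ w → w ∈ W × head w ≢ 0#} | project (0∷-subspace W-sub) (tail e)
  ... | no ∄w | p′ , p′∈ , p′-proj = 0∷ p′ , p′∈ , λ v v∈ →
    let v₀≡0 : head v ≡ 0#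
        v₀≡0 = decidable-stable em (λ v₀≢0 → ∄w (v , v∈ , v₀≢0))
    in cong₂ _+_
      (trans (cong (_* e zero) v₀≡0) (trans (zeroˡ _) (sym (zeroʳ _))))
      (p′-proj (tail v) (Subspace.resp W-sub (λ { zero → v₀≡0 ; (suc j) → refl }) v∈))
  ... | yes (w , w∈ , w₀≢0) | p′ , p′∈ , p′-proj with project (0∷-subspace W-sub) (tail w)
  ...   | w′ , w′∈ , w′-proj = p , +-closed (*-closed c d∈) p′∈ , p-proj
    where
    open Subspace W-sub

    -- Subtracting from `w` the projection of its tail keeps the nonzero first entry and makes `d`
    -- orthogonal to every `0∷ v` in `W`.
    d : Vector ℝ (suc n)
    d j = - 1# * (0∷ w′) j + w j

    d∈ : d ∈ W
    d∈ = +-closed (*-closed (- 1#) w′∈) w∈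

    d₀≢0 : head d ≢ 0#
    d₀≢0 d₀≡0 = w₀≢0 (trans (sym (trans (cong (_+ head w) (zeroʳ (- 1#))) (+-identityˡ _))) d₀≡0)

    d⊥ : ∀ v → 0∷ v ∈ W → v ∙ tail d ≡ 0#
    d⊥ v v∈ = begin
      v ∙ tail d                   ≡⟨ ∙-linearʳ v w′ (tail w) (- 1#) ⟩
      - 1# * (v ∙ w′) + v ∙ tail w ≡⟨ cong₂ _+_ (-1*x≈-x (v ∙ w′)) (w′-proj v v∈) ⟩
      - (v ∙ w′) + v ∙ w′          ≡⟨ -‿inverseˡ (v ∙ w′) ⟩
      0#                           ∎

    dd≢0 : d ∙ d ≢ 0#
    dd≢0 dd≡0 = d₀≢0 (x*x≡0⇒x≡0 (nonNeg-sum-≡0 (sum-nonNeg (λ j → 0≤x*x (d (suc j)))) (0≤x*x (d zero))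
      (trans (+-comm _ _) dd≡0)))

    -- The Fourier coefficient of `e` along `d`, so that `c d` is the projection of `e` onto the
    -- line of `d`.
    c : ℝ
    c = d ∙ e * proj₁ (inverse (d ∙ d) dd≢0)

    p : Vector ℝ (suc n)
    p j = c * d j + (0∷ p′) j

    d-proj : d ∙ p ≡ d ∙ e
    d-proj = begin
      d ∙ p
        ≡⟨ ∙-linearʳ d d (0∷ p′) c ⟩
      c * (d ∙ d) + d ∙ (0∷ p′)
        ≡⟨ cong₂ _+_ (x*y⁻¹*y≡x (d ∙ e) dd≢0)
                     (trans (∙-comm d (0∷ p′)) (trans (0∷-∙ p′ d) (d⊥ p′ p′∈))) ⟩
      d ∙ e + 0#
        ≡⟨ +-identityʳ _ ⟩
      d ∙ e ∎

    0∷-proj : ∀ v → 0∷ v ∈ W → (0∷ v) ∙ p ≡ (0∷ v) ∙ e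
    0∷-proj v v∈ = begin
      (0∷ v) ∙ p                    ≡⟨ 0∷-∙ v p ⟩
      v ∙ tail p                    ≡⟨ ∙-linearʳ v (tail d) p′ c ⟩
      c * (v ∙ tail d) + v ∙ p′     ≡⟨ cong₂ _+_ (trans (cong (c *_) (d⊥ v v∈)) (zeroʳ c)) (sym (p′-proj v v∈)) ⟩
      0# + v ∙ tail e               ≡⟨ +-identityˡ _ ⟩
      v ∙ tail e                    ≡⟨ 0∷-∙ v e ⟨
      (0∷ v) ∙ e                    ∎

    p-proj : ∀ v → v ∈ W → v ∙ e ≡ v ∙ p
    p-proj v v∈ = begin
      v ∙ e                        ≡⟨ split e ⟩
      s * (d ∙ e) + (0∷ v′) ∙ e    ≡⟨ cong₂ (λ x y → s * x + y) d-proj (0∷-proj v′ v′∈) ⟨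
      s * (d ∙ p) + (0∷ v′) ∙ p    ≡⟨ split p ⟨
      v ∙ p                        ∎
      where
      -- Chosen so that `v - s d` has first entry zero. Thus `v` splits into a multiple of `d` and a
      -- vector `0∷ v′` of `W`, and both pieces are already settled.
      s : ℝ
      s = head v * proj₁ (inverse (head d) d₀≢0)

      s*d₀ : s * head d ≡ head v
      s*d₀ = x*y⁻¹*y≡x (head v) d₀≢0

      v′ : Vector ℝ n
      v′ j = - s * d (suc j) + v (suc j)

      cancel : ∀ x y → s * x + (- s * x + y) ≡ y
      cancel x y = begin
        s * x + (- s * x + y)  ≡⟨ +-assoc _ _ _ ⟨
        s * x + - s * x + y    ≡⟨ cong (_+ y) (distribʳ x s (- s)) ⟨
        (s + - s) * x + y      ≡⟨ cong (λ z → z * x + y) (-‿inverseʳ s) ⟩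
        0# * x + y             ≡⟨ 0*x+y≡y x y ⟩
        y                      ∎

      v′∈ : 0∷ v′ ∈ W
      v′∈ = resp
        (λ { zero    → trans (cong (- s * head d +_) (sym s*d₀))
                         (trans (sym (distribʳ _ _ _))
                           (trans (cong (_* head d) (-‿inverseˡ s)) (zeroˡ _)))
           ; (suc j) → refl })
        (+-closed (*-closed (- s) d∈) v∈)

      decompose : v ≗ λ j → s * d j + (0∷ v′) j
      decompose zero    = sym (trans (+-identityʳ _) s*d₀)
      decompose (suc j) = sym (cancel (d (suc j)) (v (suc j)))

      split : ∀ u → v ∙ u ≡ s * (d ∙ u) + (0∷ v′) ∙ u
      split u = trans (sum-cong-≗ (λ j → cong (_* u j) (decompose j))) (∙-linearˡ d (0∷ v′) u s)

  -- Spans, bases and dimension.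

  Span : ∀ {A : Set} {n} → Vector (A → ℝ) n → Pred (A → ℝ) 0ℓ
  Span b f = ∃ λ c → f ≗ combination b c

  HasDimension-resp : ∀ {A : Set} {S T : Pred (A → ℝ) 0ℓ} {d} →
                      (∀ f → f ∈ S → f ∈ T) → (∀ f → f ∈ T → f ∈ S) → HasDimension R S d → HasDimension R T d
  HasDimension-resp S⊆T T⊆S (b , b∈ , spanning , independent) =
    b , (λ j → S⊆T (b j) (b∈ j)) , (λ f → spanning f ∘ T⊆S f) , independent

  -- Extracts a basis from the end of the family backwards: the head is dropped if it lies in the
  -- span of the tail and kept otherwise, which excluded middle decides.
  Span-dimension : ∀ {A : Set} {n} (b : Vector (A → ℝ) n) → ∃ λ d → d ℕ.≤ n × HasDimension R (Span b) d
  Span-dimension {n = zero}      b = 0 , ℕ.z≤n , b , (λ ()) , (λ f f∈ → f∈) , (λ c _ ())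
  Span-dimension {A} {suc n} b with Span-dimension (tail b) | em {head b ∈ Span (tail b)}
  ... | d , d≤n , dim | yes (h , b₀≗) = d , ℕ.m≤n⇒m≤1+n d≤n , HasDimension-resp
    (λ { f (c , f≗) → 0∷ c , λ a → trans (f≗ a) (sym (0∷-∙ c (λ j → b j a))) })
    (λ { f (c , f≗) → (λ j → head c * h j + tail c j) , λ a → trans (f≗ a) (sym
           (trans (combination-+ (tail b) (λ j → head c * h j) (tail c) a)
             (cong (_+ combination (tail b) (tail c) a) (trans (combination-* (tail b) (head c) h a)
                                 (cong (head c *_) (sym (b₀≗ a))))))) })
    dim
  ... | d , d≤n , (b′ , b′∈ , spanning , independent) | no b₀∉ =
    suc d , ℕ.s≤s d≤n , head b Vector.∷ b′ , ∷∈ , ∷-spanning , ∷-independent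
    where
    ∷∈ : ∀ j → (head b Vector.∷ b′) j ∈ Span b
    ∷∈ zero    = unit zero , λ a → sym (combination-unit b zero a)
    ∷∈ (suc j) = 0∷ proj₁ (b′∈ j) , λ a → trans (proj₂ (b′∈ j) a)
      (sym (0∷-∙ (proj₁ (b′∈ j)) (λ i → b i a)))

    ∷-spanning : ∀ f → f ∈ Span b → f ∈ Span (head b Vector.∷ b′)
    ∷-spanning f (c , f≗) with spanning (combination (tail b) (tail c)) (tail c , λ _ → refl)
    ... | c′ , eq = head c Vector.∷ c′ , λ a → trans (f≗ a) (cong (head c * head b a +_) (eq a))

    Span-subspace : Subspace (Span (tail b))
    Span-subspace = record
      { resp     = λ { f≗g (c , f≗) → c , λ a → trans (sym (f≗g a)) (f≗ a) }
      ; 0-closed = (λ _ → 0#) , λ a → sym (combination-0 (tail b) a)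
      ; +-closed = λ { (c , f≗) (c′ , g≗) → _ , λ a →
          trans (cong₂ _+_ (f≗ a) (g≗ a)) (sym (combination-+ (tail b) c c′ a)) }
      ; *-closed = λ { r (c , f≗) → _ , λ a →
          trans (cong (r *_) (f≗ a)) (sym (combination-* (tail b) r c a)) }
      }

    ∷-independent : ∀ c → combination (head b Vector.∷ b′) c ≗ (λ _ → 0#) → c ≗ (λ _ → 0#)
    ∷-independent c ≗0 = λ { zero → c₀≡0 ; (suc j) → independent (tail c) tail≗0 j }
      where
      open Subspace Span-subspace

      -- A nonzero leading coefficient could be divided out of the relation, putting `head b` in the
      -- span of the tail.
      c₀≡0 : head c ≡ 0#
      c₀≡0 = decidable-stable em λ c₀≢0 → b₀∉
        (resp (λ a → *-cancelʳ-≡ c₀≢0 (solution c₀≢0 a))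
              (*-closed (- proj₁ (inverse (head c) c₀≢0)) (combination-closed b′∈ (tail c))))
        where
        solution : ∀ c₀≢0 a →
          - proj₁ (inverse (head c) c₀≢0) * combination b′ (tail c) a * head c ≡ head b a * head c
        solution c₀≢0 a = begin
          - r * x * head c        ≡⟨ *-assoc (- r) x _ ⟩
          - r * (x * head c)      ≡⟨ cong (- r *_) (*-comm x _) ⟩
          - r * (head c * x)      ≡⟨ *-assoc (- r) _ x ⟨
          - r * head c * x        ≡⟨ cong (_* x) (-‿distribˡ-* r (head c)) ⟨
          - (r * head c) * x      ≡⟨ cong (λ z → - z * x) (trans (*-comm r _) (proj₂ (inverse (head c) c₀≢0))) ⟩
          - 1# * x                ≡⟨ -1*x≈-x x ⟩
          - x                     ≡⟨ +-inverseˡ-unique _ x (≗0 a) ⟨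
          head c * head b a       ≡⟨ *-comm _ _ ⟩
          head b a * head c       ∎
          where
          r x : ℝ
          r = proj₁ (inverse (head c) c₀≢0)
          x = combination b′ (tail c) a

      tail≗0 : combination b′ (tail c) ≗ (λ _ → 0#)
      tail≗0 a = trans (sym (trans
        (cong (λ x → x * head b a + combination b′ (tail c) a) c₀≡0)
        (0*x+y≡y (head b a) (combination b′ (tail c) a)))) (≗0 a)

  -- The basis is the standard one transported along `e`; the coefficients of a function are its
  -- values.
  finite-dimension : ∀ {A : Set} {d} → Fin d ↔ A → HasDimension R {A} U d
  finite-dimension {A} {d} e = b , (λ _ → _) ,
      (λ f _ → f ∘ to e , λ a → sym (trans (coefficient (f ∘ to e) a) (cong f (strictlyInverseˡ e a)))) ,
      (λ c ≗0 j → trans (sym (trans (coefficient c (to e j)) (cong c (strictlyInverseʳ e j)))) (≗0 (to e j)))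
    where
    b : Vector (A → ℝ) d
    b j a = unit (from e a) j

    coefficient : ∀ c a → combination b c a ≡ c (from e a)
    coefficient c a = trans (∙-comm c _) (combination-unit (λ j _ → c j) (from e a) a)

  -- Reproducing kernel Hilbert spaces with finitely many features.

  module FiniteFeatures {A : Set} {k : A → A → ℝ} {n} (φ : Vector (A → ℝ) n)
    (k≡ : ∀ x x′ → k x x′ ≡ (λ j → φ j x) ∙ (λ j → φ j x′)) (H : RKHS R k) where
    open RKHS H

    space-subspace : Subspace space
    space-subspace = record { resp = ∈-resp ; 0-closed = 0∈ ; +-closed = +∈ ; *-closed = *∈ }

    combination∈space : ∀ c → combination φ c ∈ space
    -- The subspace consists of the coefficient vectors whose combination of features lies in
    -- `space`.
    combination∈space c with project (record
      { resp     = λ v≗v′ → ∈-resp (combination-cong φ v≗v′)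
      ; 0-closed = ∈-resp (λ x → sym (combination-0 φ x)) 0∈
      ; +-closed = λ v∈ v′∈ → ∈-resp (λ x → sym (combination-+ φ _ _ x)) (+∈ v∈ v′∈)
      ; *-closed = λ r v∈ → ∈-resp (λ x → sym (combination-* φ r _ x)) (*∈ r v∈)
      }) c
    -- The kernel section at `x` is the combination with coefficient vector `φ(x)`, so `kernel∈ x`
    -- puts that vector in the subspace. Hence `p` and `c` define the same function.
    ... | p , p∈ , p-proj = ∈-resp
      (λ x → trans (∙-comm p _)
        (trans (sym (p-proj (λ j → φ j x)
                 (∈-resp (λ x′ → trans (k≡ x′ x) (∙-comm (λ j → φ j x′) _)) (kernel∈ x))))
               (∙-comm _ c)))
      p∈

    feature∈space : ∀ j → φ j ∈ space
    feature∈space j = ∈-resp (combination-unit φ j) (combination∈space (unit j))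

    ⟨combination,⟩ : ∀ {m} {b : Vector (A → ℝ) m} {h} → (∀ j → b j ∈ space) → h ∈ space →
                     ∀ c → ⟨ combination b c , h ⟩ ≡ c ∙ (λ j → ⟨ b j , h ⟩)
    ⟨combination,⟩ {zero} {h = h} b∈ h∈ c = begin
      -- Writing the zero function as `0#` times itself lets homogeneity evaluate the inner product.
      ⟨ (λ _ → 0#) , h ⟩         ≡⟨ ⟨⟩-cong 0∈ h∈ (λ _ → sym (zeroˡ 0#)) (λ _ → refl) ⟩
      ⟨ (λ _ → 0# * 0#) , h ⟩    ≡⟨ ⟨⟩-* 0# 0∈ h∈ ⟩
      0# * ⟨ (λ _ → 0#) , h ⟩    ≡⟨ zeroˡ _ ⟩
      0#                         ∎
    ⟨combination,⟩ {suc m} b∈ h∈ c = trans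
      (⟨⟩-+ (*∈ (c zero) (b∈ zero)) (Subspace.combination-closed space-subspace (b∈ ∘ suc) (tail c)) h∈)
      (cong₂ _+_ (⟨⟩-* (c zero) (b∈ zero) h∈) (⟨combination,⟩ (b∈ ∘ suc) h∈ (tail c)))

    -- The coefficients are the inner products of `f` with the features. Expanding the kernel
    -- section inside the inner product requires `feature∈space`, because the inner-product laws
    -- hold only on members.
    space⊆Span : ∀ f → f ∈ space → f ∈ Span φ
    space⊆Span f f∈ = (λ j → ⟨ φ j , f ⟩) , λ x → begin
      f x                                            ≡⟨ reproducing f∈ x ⟨
      ⟨ f , (λ x′ → k x′ x) ⟩                        ≡⟨ ⟨⟩-sym f∈ (kernel∈ x) ⟩
      ⟨ (λ x′ → k x′ x) , f ⟩
        ≡⟨ ⟨⟩-cong (kernel∈ x) f∈ (λ x′ → trans (k≡ x′ x) (∙-comm (λ j → φ j x′) _)) (λ _ → refl) ⟩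
      ⟨ combination φ (λ j → φ j x) , f ⟩            ≡⟨ ⟨combination,⟩ feature∈space f∈ (λ j → φ j x) ⟩
      (λ j → φ j x) ∙ (λ j → ⟨ φ j , f ⟩)            ≡⟨ ∙-comm (λ j → φ j x) _ ⟩
      combination φ (λ j → ⟨ φ j , f ⟩) x            ∎

    space-dimension : ∃ λ d → d ℕ.≤ n × HasDimension R space d
    space-dimension with Span-dimension φ
    ... | d , d≤n , dim = d , d≤n , HasDimension-resp
      (λ { f (c , f≗) → ∈-resp (λ x → sym (f≗ x)) (combination∈space c) }) space⊆Span dim

-- The binary-tree kernel and its features.

module Tree (em : ExcludedMiddle 0ℓ) (R : RealNumbers) {n : ℕ} {𝕏 : Pred (Vec (RealNumbers.ℝ R) n) 0ℓ}
  {q : ℕ} (Ψ : Refinement (Vec (RealNumbers.ℝ R) n) 𝕏 → Vec Bool q) where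
  open RealNumbers R
  open OrderedField em R
  open LinearAlgebra em R
  open BinaryTree R Ψ
  open SemiringSum semiring using (sum-cong-≗)
  open RingSolver commutativeSemiring using (solve; _:=_; _:*_)
  open ≡-Reasoning

  ∑𝔹-sum : ∀ m g → ∑𝔹 m g ≡ sum (g ∘ to (bits-↔ m))
  ∑𝔹-sum zero    g = sym (+-identityʳ (g []))
  ∑𝔹-sum (suc m) g = begin
    ∑𝔹 m g₀ + ∑𝔹 m g₁
      -- The extra `0#` is the empty tail of the sum over the two values of the first bit.
      ≡⟨ cong₂ _+_ (∑𝔹-sum m g₀) (trans (∑𝔹-sum m g₁) (sym (+-identityʳ _))) ⟩
    sum (g₀ ∘ to (bits-↔ m)) + (sum (g₁ ∘ to (bits-↔ m)) + 0#)
      ≡⟨ sum-Σ-↔ (λ (_ : Fin 2) → bits-↔ m) (g ∘ to ∷-↔) ⟨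
    sum (g ∘ to (bits-↔ (suc m))) ∎
    where
    g₀ g₁ : Vec Bool m → ℝ
    g₀ s = g (false ∷ s)
    g₁ s = g (true ∷ s)

  ∑𝔹-cong : ∀ {m g h} → g ≗ h → ∑𝔹 m g ≡ ∑𝔹 m h
  ∑𝔹-cong {zero}  g≗h = g≗h []
  ∑𝔹-cong {suc m} g≗h = cong₂ _+_ (∑𝔹-cong (g≗h ∘ (false ∷_))) (∑𝔹-cong (g≗h ∘ (true ∷_)))

  *-distribˡ-∑𝔹 : ∀ m r g → r * ∑𝔹 m g ≡ ∑[ s ∈𝔹 m ] (r * g s)
  *-distribˡ-∑𝔹 zero    r g = refl
  *-distribˡ-∑𝔹 (suc m) r g =
    trans (distribˡ r _ _) (cong₂ _+_ (*-distribˡ-∑𝔹 m r _) (*-distribˡ-∑𝔹 m r _))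

  ∑𝔹-pick : ∀ {m} g (s : Vec Bool m) → (∀ t → s ≢ t → g t ≡ 0#) → ∑𝔹 m g ≡ g s
  ∑𝔹-pick {m} g s g≡0 = begin
    ∑𝔹 m g                   ≡⟨ ∑𝔹-sum m g ⟩
    sum (g ∘ to bits)        ≡⟨ sum-pick (g ∘ to bits) (from bits s) (λ j j≢ → g≡0 (to bits j)
                                  λ { refl → j≢ (sym (strictlyInverseʳ bits j)) }) ⟩
    g (to bits (from bits s)) ≡⟨ cong g (strictlyInverseˡ bits s) ⟩
    g s                      ∎
    where
    bits : Fin (2 ℕ.^ m) ↔ Vec Bool m
    bits = bits-↔ m

  node : Fin (featureDimension q) → Node q
  node = to (node-↔ q)

  ∑-nodes : ∀ g → ∑[ i < q ] (∑[ s ∈𝔹 level i ] g (i , s)) ≡ sum (g ∘ node)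
  ∑-nodes g = trans (sum-cong-≗ (λ i → ∑𝔹-sum (level i) (λ s → g (i , s))))
                    (sym (sum-Σ-↔ (λ i → bits-↔ (level i)) g))

  module _ (w : Fin q → ℝ) (w≥0 : ∀ i → 0# ≤ w i) where

    φ : Vector (Point → ℝ) (featureDimension q)
    φ j x = φ̂ w w≥0 x (node j)

    -- At each level only the node `s = prefix i x` contributes, and there the two factors `√ (w i)`
    -- multiply to `w i`.
    k̂≡φ̂·φ̂ : ∀ x x′ → k̂ w x x′ ≡ φ̂ w w≥0 x · φ̂ w w≥0 x′
    k̂≡φ̂·φ̂ x x′ = sum-cong-≗ (sym ∘ same-level)
      where
      same-level : ∀ i → ∑[ s ∈𝔹 level i ] (φ̂ w w≥0 x (i , s) * φ̂ w w≥0 x′ (i , s)) ≡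
                         w i * 𝟏 (prefix i x ≟ prefix i x′)
      same-level i = begin
        ∑[ s ∈𝔹 level i ] (r * 𝟏 (p ≟ s) * (r * 𝟏 (p′ ≟ s)))
          ≡⟨ ∑𝔹-pick _ p (λ s p≢s →
               trans (cong (λ z → r * z * (r * 𝟏 (p′ ≟ s))) (𝟏-no (p ≟ s) p≢s))
                     (trans (cong (_* (r * 𝟏 (p′ ≟ s))) (zeroʳ r)) (zeroˡ _))) ⟩
        r * 𝟏 (p ≟ p) * (r * 𝟏 (p′ ≟ p))
          ≡⟨ cong₂ (λ y z → r * y * (r * z)) (𝟏-yes (p ≟ p) refl) (𝟏-sym p′ p) ⟩
        r * 1# * (r * 𝟏 (p ≟ p′))
          ≡⟨ cong (_* (r * 𝟏 (p ≟ p′))) (*-identityʳ r) ⟩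
        r * (r * 𝟏 (p ≟ p′))
          ≡⟨ *-assoc r r _ ⟨
        r * r * 𝟏 (p ≟ p′)
          ≡⟨ cong (_* 𝟏 (p ≟ p′)) (√-square (w i) (w≥0 i)) ⟩
        w i * 𝟏 (p ≟ p′) ∎
        where
        r : ℝ
        r = √ (w i) (w≥0 i)
        p p′ : Vec Bool (level i)
        p = prefix i x
        p′ = prefix i x′
        𝟏-sym : ∀ s t → 𝟏 (s ≟ t) ≡ 𝟏 (t ≟ s)
        𝟏-sym s t with t ≟ s
        ... | yes t≡s = 𝟏-yes (s ≟ t) (sym t≡s)
        ... | no  t≢s = 𝟏-no (s ≟ t) (t≢s ∘ sym)

    k̂≡φ∙φ : ∀ x x′ → k̂ w x x′ ≡ (λ j → φ j x) ∙ (λ j → φ j x′)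
    k̂≡φ∙φ x x′ = trans (k̂≡φ̂·φ̂ x x′) (∑-nodes (λ a → φ̂ w w≥0 x a * φ̂ w w≥0 x′ a))

    treeFunction≗combination : ∀ y → treeFunction w w≥0 y ≗ combination φ (y ∘ node)
    treeFunction≗combination y x = trans (sum-cong-≗ same-level) (∑-nodes (λ a → y a * φ̂ w w≥0 x a))
      where
      same-level : ∀ i → √ (w i) (w≥0 i) * ∑[ s ∈𝔹 level i ] (y (i , s) * 𝟏 (Ξ? i s x)) ≡
                         ∑[ s ∈𝔹 level i ] (y (i , s) * φ̂ w w≥0 x (i , s))
      same-level i = trans 
        (*-distribˡ-∑𝔹 (level i) (√ (w i) (w≥0 i)) (λ s → y (i , s) * 𝟏 (Ξ? i s x)))
        (∑𝔹-cong {level i} {h = λ s → y (i , s) * φ̂ w w≥0 x (i , s)} (λ s → solve 3 (λ r y z → r :* (y :* z) := y :* (r :* z)) refl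
          (√ (w i) (w≥0 i)) (y (i , s)) (𝟏 (Ξ? i s x))))

    combination≗treeFunction : ∀ c → combination φ c ≗ treeFunction w w≥0 (c ∘ from (node-↔ q))
    combination≗treeFunction c x = trans
      (combination-cong φ (λ j → cong c (sym (strictlyInverseʳ (node-↔ q) j))) x)
      (sym (treeFunction≗combination (c ∘ from (node-↔ q)) x))

-- The number `featureDimension q` is the exact dimension of the space of feature coordinates and an
-- upper bound for that of `space`, since features may be dependent: the indicator of an inner node
-- is the sum of those of its two children, and an empty cell or a zero weight gives a zero feature.
theorem1 : ExcludedMiddle 0ℓ →
    (R : RealNumbers) → let open RealNumbers R in
    (n : ℕ) (𝕏 : Pred (Vec ℝ n) 0ℓ)
    (q : ℕ) (Ψ : Refinement (Vec ℝ n) 𝕏 → Vec Bool q) → let open BinaryTree R Ψ in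
    (w : Fin q → ℝ) (w≥0 : ∀ i → 0# ≤ w i) →
    ∑[ i < q ] (w i) ≡ 1# →
    (∀ x x′ → k̂ w x x′ ≡ φ̂ w w≥0 x · φ̂ w w≥0 x′)
    × HasDimension R {Node q} U (featureDimension q)
    × ((H : RKHS R (k̂ w)) → let open RKHS H in
    (∀ f → f ∈ space → ∃ λ y → f ≗ treeFunction w w≥0 y)
    × (∀ y → treeFunction w w≥0 y ∈ space)
    × (∃ λ d → d ℕ.≤ featureDimension q × HasDimension R space d))
theorem1 em R n 𝕏 q Ψ w w≥0 _ = k̂≡φ̂·φ̂ w w≥0 , finite-dimension (node-↔ q) , λ H →
  let open RKHS H
      open FiniteFeatures (φ w w≥0) (k̂≡φ∙φ w w≥0) H
  in
    (λ f f∈ → let c , f≗ = space⊆Span f f∈ in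
      c ∘ from (node-↔ q) , λ x → trans (f≗ x) (combination≗treeFunction w w≥0 c x))
  , (λ y → ∈-resp (λ x → sym (treeFunction≗combination w w≥0 y x)) (combination∈space (y ∘ node)))
  , space-dimension
  where
  open LinearAlgebra em R
  open Tree em R Ψ
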